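{- Let $a_1,\dots,a_k$ be positive integers with $\gcd(a_1,\dots,a_k)=1$, let $\mathit{NR}$ be the (finite) set of positive integers that are not representable, and let $a$ be one of the $a_i$. Let $\mathcal{N}$ be the set of positive integers $n$ such that $n$ is representable and $n-a$ is not representable. Then for every function $f:\mathbb{Z}\to\mathbb{C}$, \[ \sum_{n\in\mathit{NR}}\bigl[f(n+a)-f(n)\bigr]=\sum_{n\in\mathcal{N}}f(n)-\sum_{n=1}^{a-1}f(n). \]
   Context: An integer $n$ is called representable (with respect to $a_1,\dots,a_k$) if $n=\sum_{i=1}^k a_ix_i$ for some nonnegative integers $x_1,\dots,x_k$; in particular $0$ is representable and negative integers are not. -}

module Defs where

open import Algebra.Bundles using (AbelianGroup)
import Algebra.Properties.CommutativeMonoid.Sum as Sum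
open import Data.Integer.Base as ℤ using (ℤ; +_; 0ℤ; _<_)
open import Data.List.Base as List using (List; map; upTo)
open import Data.List.Membership.Propositional using (_∈_)
open import Data.List.Relation.Unary.Unique.Propositional using (Unique)
open import Data.Nat.Base as ℕ using (ℕ; suc; _∸_)
open import Data.Nat.GCD using (gcd)
import Data.Nat.Properties as ℕ
open import Data.Product.Base using (_×_; Σ-syntax)
open import Data.Vec.Functional as Vector using (Vector)
open import Function.Bundles using (_⇔_)
open import Level using (Level)
open import Relation.Binary.PropositionalEquality.Core using (_≡_)
open import Relation.Nullary.Negation.Core using (¬_)
open import Relation.Unary using (Pred)

open Sum ℕ.+-0-commutativeMonoid using (sum)

private
  variable
    k : ℕ
    p : Level

gcdᵥ : Vector ℕ k → ℕ
gcdᵥ = Vector.foldr gcd 0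

Representable : Vector ℕ k → ℤ → Set
Representable {k} a n = Σ[ x ∈ Vector ℕ k ] n ≡ + sum (λ i → a i ℕ.* x i)

NR : Vector ℕ k → ℤ → Set
NR a n = 0ℤ < n × ¬ Representable a n

𝒩 : Vector ℕ k → ℕ → ℤ → Set
𝒩 a m n = 0ℤ < n × Representable a n × ¬ Representable a (n ℤ.- + m)

-- Finiteness of a set of integers, witnessed by a repetition-free list of
-- exactly its elements.
record Finite (P : Pred ℤ p) : Set p where
  field
    elements : List ℤ
    unique   : Unique elements
    exact    : ∀ n → n ∈ elements ⇔ P n

open Finite public using (elements)

-- The integers 1, …, m - 1 (none if m ≤ 1).
[1⋯_-1] : ℕ → List ℤ
[1⋯ m -1] = map (λ j → + suc j) (upTo (m ∸ 1))

-- Values are taken in an arbitrary abelian group; complex-valued functions are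
-- the case where G is the additive group of ℂ.
module _ {c ℓ} (G : AbelianGroup c ℓ) where
  open AbelianGroup G

  sumOver : List ℤ → (ℤ → Carrier) → Carrier
  sumOver ns f = List.foldr _∙_ ε (map f ns)

{-# OPTIONS --safe #-}

-- Write m for the chosen generator. Both NR + m together with {1, …, m - 1}, and
-- 𝒩 together with NR, are repetition-free lists of the positive n for which
-- n - m is not representable. Hence they are permutations of each other and give
-- the same sum of f.

module Submission where

open import Defs
open import Algebra.Bundles using (AbelianGroup)
open import Data.Fin.Base using (Fin)
open import Data.Integer.Base as ℤ using (ℤ; +_)
open import Data.Nat.Base as ℕ using (ℕ)
open import Data.Product.Base using (_×_)
open import Data.Vec.Functional using (Vector)
open import Relation.Binary.PropositionalEquality.Core using (_≡_)

import Algebra.Properties.AbelianGroup as AbelianGroupProperties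
import Algebra.Properties.CommutativeMonoid.Sum as Sum
import Algebra.Properties.CommutativeSemigroup as CommutativeSemigroupProperties
open import Data.Fin.Base using (zero; suc)
open import Data.Integer.Base using (0ℤ; +≤+; +<+)
import Data.Integer.Properties as ℤ
open import Data.List.Base using (List; []; _∷_; _++_; map; filter)
open import Data.List.Membership.Propositional using (_∈_)
open import Data.List.Membership.Propositional.Properties
  using (∈-map⁺; ∈-map⁻; ∈-++⁺ˡ; ∈-++⁺ʳ; ∈-++⁻; ∈-upTo⁺; ∈-upTo⁻; ∈-filter⁺; ∈-filter⁻)
open import Data.List.Membership.Propositional.Properties.WithK using (unique∧set⇒bag)
open import Data.List.Relation.Binary.BagAndSetEquality using (∼bag⇒↭)
open import Data.List.Relation.Binary.Disjoint.Propositional using (Disjoint)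
open import Data.List.Relation.Binary.Permutation.Propositional using (_↭_; ↭⇒↭ₛ′)
import Data.List.Relation.Binary.Permutation.Propositional.Properties as ↭
import Data.List.Relation.Binary.Permutation.Setoid.Properties as ↭ₛ
open import Data.List.Relation.Unary.Unique.Propositional using (Unique)
import Data.List.Relation.Unary.Unique.Propositional.Properties as Unique
open import Data.Nat.Base using (zero; suc; _+_; _*_; _∸_; s≤s; s<s⁻¹)
open import Data.Nat.DivMod using (_/_; _%_; m≡m%n+[m/n]*n; m%n<n; m*n/n≡m; /-monoˡ-≤)
open import Data.Nat.GCD using (gcd-GCD; module Bézout)
import Data.Nat.Properties as ℕ
open import Data.Nat.Tactic.RingSolver using (solve-∀)
open import Data.Product.Base using (∃-syntax; _,_; proj₁; proj₂)
open import Data.Sum.Base using (inj₁; inj₂)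
open import Data.Vec.Functional as Vector using (head; tail)
open import Function.Base using (_∘_)
open import Function.Bundles using (_⇔_; mk⇔; Equivalence)
open import Relation.Binary.Definitions using (tri<; tri≈; tri>)
open import Relation.Binary.PropositionalEquality
  using (refl; sym; trans; cong; subst; module ≡-Reasoning)
open import Relation.Nullary.Decidable using (yes; no; map′; _×-dec_; ¬?)
open import Relation.Nullary.Negation using (¬_; contradiction)
open import Relation.Unary using (Pred; Decidable)

open Sum ℕ.+-0-commutativeMonoid using (sum; sum-cong-≗; ∑-distrib-+)
open AbelianGroupProperties ℤ.+-0-abelianGroup
  using () renaming (//-rightDividesˡ to i-j+j; //-rightDividesʳ to i+j-j; ∙-cancelʳ to +-cancelʳ)
open Equivalence using (to; from)

private
  variable
    k l n : ℕ
    a : Vector ℕ k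

-- Natural representable numbers

-- A record rather than a function into Σ, so that a and n can be inferred.
record Representableℕ {k} (a : Vector ℕ k) (n : ℕ) : Set where
  constructor _,_
  field
    coefficients : Vector ℕ k
    equation     : n ≡ sum (λ i → a i * coefficients i)

open Representableℕ using (equation)

infixr 5 _∷ᴿ_

-- Inductions on the number of generators extend a representation over `tail a` in this way.
_∷ᴿ_ : ∀ {a : Vector ℕ (suc k)} c → Representableℕ (tail a) n →
       Representableℕ a (head a * c + n)
_∷ᴿ_ {a = a} c (x , eq) = c Vector.∷ x , cong (λ s → head a * c + s) eq

Representableℕ-0 : (a : Vector ℕ k) → Representableℕ a 0
Representableℕ-0 {zero}  a = (λ ()) , refl
Representableℕ-0 {suc k} a =
  subst (Representableℕ a) (trans (ℕ.+-identityʳ _) (ℕ.*-zeroʳ (head a)))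
    (0 ∷ᴿ Representableℕ-0 (tail a))

Representableℕ-+ : Representableℕ a l → Representableℕ a n → Representableℕ a (l + n)
Representableℕ-+ {a = a} (x , refl) (y , refl) = (λ i → x i + y i) , sym (begin
  sum (λ i → a i * (x i + y i))                    ≡⟨ sum-cong-≗ (λ i → ℕ.*-distribˡ-+ (a i) (x i) (y i)) ⟩
  sum (λ i → a i * x i + a i * y i)                ≡⟨ ∑-distrib-+ (λ i → a i * x i) (λ i → a i * y i) ⟩
  sum (λ i → a i * x i) + sum (λ i → a i * y i)    ∎)
  where open ≡-Reasoning

Representableℕ-* : ∀ c → Representableℕ a n → Representableℕ a (c * n)
Representableℕ-* {a = a} zero    r = Representableℕ-0 a
Representableℕ-*         (suc c) r = Representableℕ-+ r (Representableℕ-* c r)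

Representableℕ-generator : (a : Vector ℕ k) → ∀ i → Representableℕ a (a i)
Representableℕ-generator a zero    =
  subst (Representableℕ a) (trans (ℕ.+-identityʳ _) (ℕ.*-identityʳ (head a)))
    (1 ∷ᴿ Representableℕ-0 (tail a))
Representableℕ-generator a (suc i) =
  subst (Representableℕ a) (cong (_+ a (suc i)) (ℕ.*-zeroʳ (head a)))
    (0 ∷ᴿ Representableℕ-generator (tail a) i)

-- A bounded search, by induction on the number of generators. As `head a` is positive, its
-- coefficient `c` is at most `n`, and so is the contribution `r` of the tail. The strict bound of
-- `anyUpTo?` is therefore `suc n` in both places.
Representableℕ? : (a : Vector ℕ k) → (∀ j → 0 ℕ.< a j) → Decidable (Representableℕ a)
Representableℕ? {zero}  a a>0 n = map′ (λ eq → (λ ()) , eq) equation (n ℕ.≟ 0)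
Representableℕ? {suc k} a a>0 n = map′
  (λ { (c , _ , r , _ , refl , rep) → c ∷ᴿ rep })
  (λ { (x , eq) → x zero , s≤s (x₀≤n x eq)
                , sum (λ i → a (suc i) * x (suc i)) , s≤s (subst (_ ℕ.≤_) (sym eq) (ℕ.m≤n+m _ _))
                , eq , tail x , refl })
  (ℕ.anyUpTo? (λ c → ℕ.anyUpTo? (λ r →
    n ℕ.≟ head a * c + r ×-dec Representableℕ? (tail a) (a>0 ∘ suc) r) (suc n)) (suc n))
  where
  x₀≤n : ∀ x → n ≡ sum (λ i → a i * x i) → x zero ℕ.≤ n
  x₀≤n x eq = ℕ.≤-trans (ℕ.m≤n*m (x zero) (head a) {{ℕ.>-nonZero (a>0 zero)}})
    (subst (_ ℕ.≤_) (sym eq) (ℕ.m≤m+n _ _))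

-- Bézout's identity with the negative terms moved to the other side.
bézout : (a : Vector ℕ k) → ∃[ v ] Representableℕ a v × Representableℕ a (gcdᵥ a + v)
bézout {zero}  a = 0 , Representableℕ-0 a , Representableℕ-0 a
bézout {suc k} a with bézout (tail a) | Bézout.identity (gcd-GCD (head a) (gcdᵥ (tail a)))
... | v , rv , rg+v | Bézout.+- x y eq =
  -- Write d for the full gcd, g for that of the tail, a₀ for `head a`. Here d + y g = x a₀, so
  -- scaling the tail pair by y gives d + y (g + v) = x a₀ + y v.
  _ , 0 ∷ᴿ Representableℕ-* y rg+v ,
  subst (Representableℕ a) (sym identity) (x ∷ᴿ Representableℕ-* y rv)
  where
  open ≡-Reasoning
  regroup : ∀ d y g v a₀ → d + (a₀ * 0 + y * (g + v)) ≡ (d + y * g) + y * v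
  regroup = solve-∀
  identity : gcdᵥ a + (head a * 0 + y * (gcdᵥ (tail a) + v)) ≡ head a * x + y * v
  identity = begin
    gcdᵥ a + (head a * 0 + y * (gcdᵥ (tail a) + v))  ≡⟨ regroup (gcdᵥ a) y (gcdᵥ (tail a)) v (head a) ⟩
    (gcdᵥ a + y * gcdᵥ (tail a)) + y * v             ≡⟨ cong (_+ y * v) eq ⟩
    x * head a + y * v                               ≡⟨ cong (_+ y * v) (ℕ.*-comm x (head a)) ⟩
    head a * x + y * v                               ∎
... | v , rv , rg+v | Bézout.-+ x y eq =
  -- Now d + x a₀ = y g, so the two sides exchange roles: d + (x a₀ + y v) = y (g + v).
  _ , x ∷ᴿ Representableℕ-* y rv ,
  subst (Representableℕ a) (sym identity) (0 ∷ᴿ Representableℕ-* y rg+v)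
  where
  open ≡-Reasoning
  regroup₁ : ∀ d x a₀ w → d + (a₀ * x + w) ≡ (d + x * a₀) + w
  regroup₁ = solve-∀
  regroup₂ : ∀ y g v a₀ → y * g + y * v ≡ a₀ * 0 + y * (g + v)
  regroup₂ = solve-∀
  identity : gcdᵥ a + (head a * x + y * v) ≡ head a * 0 + y * (gcdᵥ (tail a) + v)
  identity = begin
    gcdᵥ a + (head a * x + y * v)               ≡⟨ regroup₁ (gcdᵥ a) x (head a) (y * v) ⟩
    (gcdᵥ a + x * head a) + y * v               ≡⟨ cong (_+ y * v) eq ⟩
    y * gcdᵥ (tail a) + y * v                   ≡⟨ regroup₂ y (gcdᵥ (tail a)) v (head a) ⟩
    head a * 0 + y * (gcdᵥ (tail a) + v)        ∎

-- With v and 1 + v representable and n = r + q m, where r < m and q ≥ r v, write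
-- n = (q - r v) m + r (1 + v) + (m - 1) r v.
eventually-Representableℕ : ∀ {m v} → Representableℕ a (suc m) →
  Representableℕ a v → Representableℕ a (1 + v) →
  ∀ {n} → suc m * v * suc m ℕ.≤ n → Representableℕ a n
eventually-Representableℕ {a = a} {m} {v} rm rv r1+v {n} bound =
  subst (Representableℕ a) (sym n≡)
    (Representableℕ-+ (Representableℕ-* t rm)
      (Representableℕ-+ (Representableℕ-* r r1+v) (Representableℕ-* m (Representableℕ-* r rv))))
  where
  open ≡-Reasoning
  q = n / suc m
  r = n % suc m
  t = q ∸ r * v
  -- The bound on `n` is made for this: dividing it by `suc m` yields `suc m * v ≤ q`, and `r` is
  -- below `suc m`. Hence the truncated subtraction in `t` is exact.
  r*v≤q : r * v ℕ.≤ q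
  r*v≤q = ℕ.≤-trans (ℕ.*-monoˡ-≤ v (ℕ.<⇒≤ (m%n<n n (suc m))))
    (subst (ℕ._≤ q) (m*n/n≡m (suc m * v) (suc m)) (/-monoˡ-≤ (suc m) bound))
  regroup : ∀ r t v m → r + (t + r * v) * (1 + m) ≡ t * (1 + m) + (r * (1 + v) + m * (r * v))
  regroup = solve-∀
  n≡ : n ≡ t * suc m + (r * (1 + v) + m * (r * v))
  n≡ = begin
    n                                          ≡⟨ m≡m%n+[m/n]*n n (suc m) ⟩
    r + q * suc m                              ≡⟨ cong (λ z → r + z * suc m) (ℕ.m∸n+n≡m r*v≤q) ⟨
    r + (t + r * v) * suc m                    ≡⟨ regroup r t v m ⟩
    t * suc m + (r * (1 + v) + m * (r * v))    ∎

-- Integer representable numbers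

fromℕ : Representableℕ a n → Representable a (+ n)
fromℕ (x , eq) = x , cong +_ eq

toℕ : Representable a (+ n) → Representableℕ a n
toℕ (x , eq) = x , ℤ.+-injective eq

Representable⇒0≤ : ∀ {n} → Representable a n → 0ℤ ℤ.≤ n
Representable⇒0≤ (x , refl) = +≤+ ℕ.z≤n

Representable? : (a : Vector ℕ k) → (∀ j → 0 ℕ.< a j) → Decidable (Representable a)
Representable? a a>0 (+ n)      = map′ fromℕ toℕ (Representableℕ? a a>0 n)
Representable? a a>0 ℤ.-[1+ n ] = no λ ()

Representable-+ : ∀ (a : Vector ℕ k) i {n} → Representable a n → Representable a (n ℤ.+ + a i)
Representable-+ a i (x , refl) =
  fromℕ (Representableℕ-+ (x , refl) (Representableℕ-generator a i))

-- With gcd 1 the Bézout pair `v`, `gcdᵥ a + v` becomes two consecutive representable numbers; the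
-- chosen generator serves as the modulus.
eventually-Representable : (a : Vector ℕ k) → gcdᵥ a ≡ 1 → ∀ i → 0 ℕ.< a i →
  ∃[ b ] (∀ n → + b ℤ.≤ n → Representable a n)
eventually-Representable a gcd≡1 i ai>0
  with a i | Representableℕ-generator a i | bézout a
... | suc m | rm | v , rv , rg+v =
  suc m * v * suc m , λ { (+ n) (+≤+ b≤n) → fromℕ (eventually-Representableℕ rm rv
    (subst (λ g → Representableℕ a (g + v)) gcd≡1 rg+v) b≤n) }

-- Finite sets of integers

∈-[1⋯-1] : ∀ m {n} → n ∈ [1⋯ m -1] ⇔ (0ℤ ℤ.< n × n ℤ.< + m)
∈-[1⋯-1] m {n} = mk⇔ (⇒ m) (⇐ m n)
  where
  ⇒ : ∀ m → n ∈ [1⋯ m -1] → 0ℤ ℤ.< n × n ℤ.< + m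
  ⇒ zero    ()
  ⇒ (suc m) n∈ with ∈-map⁻ _ n∈
  ... | j , j∈ , refl = +<+ ℕ.z<s , +<+ (s≤s (∈-upTo⁻ j∈))
  ⇐ : ∀ m n → 0ℤ ℤ.< n × n ℤ.< + m → n ∈ [1⋯ m -1]
  ⇐ (suc m) (+ suc j) (_ , +<+ j<m) = ∈-map⁺ _ (∈-upTo⁺ (s<s⁻¹ j<m))
  ⇐ zero    (+ suc j) (_ , +<+ ())
  ⇐ m       (+ zero)  (+<+ () , _)

[1⋯-1]-unique : ∀ m → Unique [1⋯ m -1]
[1⋯-1]-unique m = Unique.map⁺ ℤ.+[1+-injective (Unique.upTo⁺ (m ∸ 1))

-- Filtering the repetition-free list 1, ..., b - 1 by the decision procedure leaves exactly the
-- elements of `P`, still without repetition.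
finite : ∀ {p} {P : Pred ℤ p} → Decidable P → (∀ {n} → P n → 0ℤ ℤ.< n) →
  ∀ b → (∀ {n} → P n → n ℤ.< + b) → Finite P
finite P? P⇒0< b P⇒<b = record
  { elements = filter P? [1⋯ b -1]
  ; unique   = Unique.filter⁺ P? ([1⋯-1]-unique b)
  ; exact    = λ n → mk⇔ (proj₂ ∘ ∈-filter⁻ P? {xs = [1⋯ b -1]})
                         (λ Pn → ∈-filter⁺ P? (from (∈-[1⋯-1] b) (P⇒0< Pn , P⇒<b Pn)) Pn)
  }

-- Finiteness of `NR` and `𝒩`

module _ (a : Vector ℕ k) (a>0 : ∀ j → 0 ℕ.< a j) (gcd≡1 : gcdᵥ a ≡ 1) (i : Fin k) where

  private
    b = proj₁ (eventually-Representable a gcd≡1 i (a>0 i))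

    ≥b⇒Representable : ∀ n → + b ℤ.≤ n → Representable a n
    ≥b⇒Representable = proj₂ (eventually-Representable a gcd≡1 i (a>0 i))

    ¬Representable⇒<b : ∀ {n} → ¬ Representable a n → n ℤ.< + b
    ¬Representable⇒<b ¬r = ℤ.≰⇒> (¬r ∘ ≥b⇒Representable _)

  NR-finite : Finite (NR a)
  NR-finite = finite (λ n → 0ℤ ℤ.<? n ×-dec ¬? (Representable? a a>0 n)) proj₁ b
    (¬Representable⇒<b ∘ proj₂)

  -- Here it is `n - a i` that is not representable and so lies below `b`; the bound for `n` itself
  -- is `b + a i`.
  𝒩-finite : Finite (𝒩 a (a i))
  𝒩-finite = finite
    (λ n → 0ℤ ℤ.<? n ×-dec Representable? a a>0 n ×-dec ¬? (Representable? a a>0 (n ℤ.- + a i)))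
    proj₁ (b + a i)
    (λ { {n} (_ , _ , ¬r) → subst (ℤ._< + (b + a i)) (i-j+j (+ a i) n)
           (ℤ.+-monoˡ-< (+ a i) (¬Representable⇒<b ¬r)) })

-- In a repetition-free list membership has at most one proof, so having the same elements already
-- means having the same multiplicities.
unique∧⇔⇒↭ : ∀ {A : Set} {xs ys : List A} → Unique xs → Unique ys →
  (∀ {x} → x ∈ xs ⇔ x ∈ ys) → xs ↭ ys
unique∧⇔⇒↭ xs! ys! eq = ∼bag⇒↭ (unique∧set⇒bag xs! ys! eq)

-- Two decompositions of one set of integers

module _ (a : Vector ℕ k) (a>0 : ∀ j → 0 ℕ.< a j) (i : Fin k)
         (nr : Finite (NR a)) (nn : Finite (𝒩 a (a i))) where

  open Finite using (unique; exact)

  private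
    m : ℤ
    m = + a i

    nr+m : List ℤ
    nr+m = map (ℤ._+ m) (elements nr)

    -- The set that both concatenated lists enumerate. Unlike in `NR`, the condition is on `n - m`.
    Gap : ℤ → Set
    Gap n = 0ℤ ℤ.< n × ¬ Representable a (n ℤ.- m)

    ¬Representable-< : ∀ {n} → n ℤ.< m → ¬ Representable a (n ℤ.- m)
    ¬Representable-< n<m r = ℤ.<⇒≱ n<m (ℤ.0≤i-j⇒j≤i (Representable⇒0≤ {a = a} r))

    -- Elements of `NR` are positive. This gives both the positivity of the shifted elements and
    -- their disjointness from 1, ..., m - 1.
    ∈-nr+m⇒m< : ∀ {n} → n ∈ nr+m → m ℤ.< n
    ∈-nr+m⇒m< n∈ with ∈-map⁻ _ n∈
    ... | n′ , n′∈ , refl = subst (ℤ._< n′ ℤ.+ m) (ℤ.+-identityˡ m)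
      (ℤ.+-monoˡ-< m (proj₁ (to (exact nr n′) n′∈)))

    -- The position of `n` relative to `m` decides the list: below `m` the difference `n - m` is
    -- negative, hence never representable; above `m` it is positive, hence an element of `NR`.
    ∈-nr+m++[1⋯m-1] : ∀ {n} → n ∈ nr+m ++ [1⋯ a i -1] ⇔ Gap n
    ∈-nr+m++[1⋯m-1] {n} = mk⇔ ⇒ ⇐
      where
      ⇒ : n ∈ nr+m ++ [1⋯ a i -1] → Gap n
      ⇒ n∈ with ∈-++⁻ nr+m n∈
      ... | inj₂ n∈[1⋯m-1] with to (∈-[1⋯-1] (a i)) n∈[1⋯m-1]
      ...   | 0<n , n<m = 0<n , ¬Representable-< n<m
      ⇒ n∈ | inj₁ n∈nr+m with ∈-map⁻ _ n∈nr+m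
      ...   | n′ , n′∈ , refl =
        ℤ.≤-<-trans (+≤+ ℕ.z≤n) (∈-nr+m⇒m< n∈nr+m) ,
        proj₂ (to (exact nr n′) n′∈) ∘ subst (Representable a) (i+j-j m n′)
      ⇐ : Gap n → n ∈ nr+m ++ [1⋯ a i -1]
      ⇐ (0<n , ¬r) with ℤ.<-cmp n m
      ... | tri< n<m _ _  = ∈-++⁺ʳ nr+m (from (∈-[1⋯-1] (a i)) (0<n , n<m))
      -- The value `m` itself is in neither list, because `m - m = 0` is representable.
      ... | tri≈ _ refl _ = contradiction
        (subst (Representable a) (sym (ℤ.+-inverseʳ m)) (fromℕ (Representableℕ-0 a))) ¬r
      ... | tri> _ _ m<n  = ∈-++⁺ˡ (subst (_∈ nr+m) (i-j+j m n)
        (∈-map⁺ (ℤ._+ m) (from (exact nr (n ℤ.- m)) (0<n-m , ¬r))))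
        where
        0<n-m : 0ℤ ℤ.< n ℤ.- m
        0<n-m = subst (ℤ._< n ℤ.- m) (ℤ.+-inverseʳ m) (ℤ.+-monoˡ-< (ℤ.- m) m<n)

    -- Whether `n` is representable decides the list.
    ∈-nn++nr : ∀ {n} → n ∈ elements nn ++ elements nr ⇔ Gap n
    ∈-nn++nr {n} = mk⇔ ⇒ ⇐
      where
      ⇒ : n ∈ elements nn ++ elements nr → Gap n
      ⇒ n∈ with ∈-++⁻ (elements nn) n∈
      ... | inj₁ n∈nn with to (exact nn n) n∈nn
      ...   | 0<n , _ , ¬r = 0<n , ¬r
      ⇒ n∈ | inj₂ n∈nr with to (exact nr n) n∈nr
      -- If `n - m` were representable, adding the generator `m` would represent `n`.
      ...   | 0<n , ¬r =
        0<n , ¬r ∘ subst (Representable a) (i-j+j m n) ∘ Representable-+ a i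
      ⇐ : Gap n → n ∈ elements nn ++ elements nr
      ⇐ (0<n , ¬r-m) with Representable? a a>0 n
      ... | yes r = ∈-++⁺ˡ (from (exact nn n) (0<n , r , ¬r-m))
      ... | no ¬r = ∈-++⁺ʳ (elements nn) (from (exact nr n) (0<n , ¬r))

    nr+m-disjoint : Disjoint nr+m [1⋯ a i -1]
    nr+m-disjoint (n∈nr+m , n∈[1⋯m-1]) =
      ℤ.<-asym (∈-nr+m⇒m< n∈nr+m) (proj₂ (to (∈-[1⋯-1] (a i)) n∈[1⋯m-1]))

    nn-disjoint : Disjoint (elements nn) (elements nr)
    nn-disjoint {n} (n∈nn , n∈nr) =
      proj₂ (to (exact nr n) n∈nr) (proj₁ (proj₂ (to (exact nn n) n∈nn)))

  shifted-NR-↭ : map (ℤ._+ + a i) (elements nr) ++ [1⋯ a i -1] ↭ elements nn ++ elements nr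
  shifted-NR-↭ = unique∧⇔⇒↭
    (Unique.++⁺ (Unique.map⁺ (+-cancelʳ m _ _) (unique nr)) ([1⋯-1]-unique (a i)) nr+m-disjoint)
    (Unique.++⁺ (unique nn) (unique nr) nn-disjoint)
    (mk⇔ (from ∈-nn++nr ∘ to ∈-nr+m++[1⋯m-1]) (from ∈-nr+m++[1⋯m-1] ∘ to ∈-nn++nr))

-- Sums in an abelian group

module _ {c ℓ} (G : AbelianGroup c ℓ) where

  open AbelianGroup G renaming (refl to ≈-refl; sym to ≈-sym; trans to ≈-trans)
  open AbelianGroupProperties G using (//-rightDividesʳ; ⁻¹-∙-comm)
  open CommutativeSemigroupProperties commutativeSemigroup using (interchange; xy∙z≈xz∙y)
  open import Relation.Binary.Reasoning.Setoid setoid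

  sumOver-↭ : ∀ {ms ns} (f : ℤ → Carrier) → ms ↭ ns → sumOver G ms f ≈ sumOver G ns f
  sumOver-↭ f ms↭ns =
    ↭ₛ.foldr-commMonoid setoid isCommutativeMonoid (↭⇒↭ₛ′ isEquivalence (↭.map⁺ f ms↭ns))

  sumOver-++ : ∀ ms ns (f : ℤ → Carrier) →
    sumOver G (ms ++ ns) f ≈ sumOver G ms f ∙ sumOver G ns f
  sumOver-++ []       ns f = ≈-sym (identityˡ _)
  sumOver-++ (m ∷ ms) ns f = ≈-trans (∙-congˡ (sumOver-++ ms ns f)) (≈-sym (assoc _ _ _))

  sumOver-map : ∀ (g : ℤ → ℤ) ns (f : ℤ → Carrier) →
    sumOver G (map g ns) f ≡ sumOver G ns (f ∘ g)
  sumOver-map g []       f = refl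
  sumOver-map g (n ∷ ns) f = cong (f (g n) ∙_) (sumOver-map g ns f)

  sumOver-- : ∀ ns (f g : ℤ → Carrier) →
    sumOver G ns (λ n → f n - g n) ≈ sumOver G ns f - sumOver G ns g
  sumOver-- []       f g = ≈-sym (inverseʳ ε)
  sumOver-- (n ∷ ns) f g = begin
    (f n - g n) ∙ sumOver G ns (λ n → f n - g n)      ≈⟨ ∙-congˡ (sumOver-- ns f g) ⟩
    (f n - g n) ∙ (sumOver G ns f - sumOver G ns g)   ≈⟨ interchange _ _ _ _ ⟩
    (f n ∙ sumOver G ns f) ∙ (g n ⁻¹ ∙ sumOver G ns g ⁻¹)  ≈⟨ ∙-congˡ (⁻¹-∙-comm _ _) ⟩
    (f n ∙ sumOver G ns f) - (g n ∙ sumOver G ns g)   ∎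

  -- The permutation yields an equation without subtraction; cancelling `y` on the left and `z` on
  -- the right brings it to the form of the theorem.
  w∙y≈x∙z⇒w-z≈x-y : ∀ {w x y z} → w ∙ y ≈ x ∙ z → w - z ≈ x - y
  w∙y≈x∙z⇒w-z≈x-y {w} {x} {y} {z} eq = begin
    w - z              ≈⟨ ∙-congʳ (//-rightDividesʳ y w) ⟨
    ((w ∙ y) - y) - z  ≈⟨ ∙-congʳ (∙-congʳ eq) ⟩
    ((x ∙ z) - y) - z  ≈⟨ ∙-congʳ (xy∙z≈xz∙y x z (y ⁻¹)) ⟩
    ((x - y) ∙ z) - z  ≈⟨ //-rightDividesʳ z (x - y) ⟩
    x - y              ∎

  -- The sum of differences splits, and the sum of the shifted values is the sum of `f` over the
  -- translated list, to which the permutation applies.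
  sumOver-NR-shift : ∀ (a : Vector ℕ k) → (∀ j → 0 ℕ.< a j) → (i : Fin k) →
    (nr : Finite (NR a)) (nn : Finite (𝒩 a (a i))) (f : ℤ → Carrier) →
    sumOver G (elements nr) (λ n → f (n ℤ.+ + a i) - f n)
      ≈ sumOver G (elements nn) f - sumOver G [1⋯ a i -1] f
  sumOver-NR-shift a a>0 i nr nn f = begin
    sumOver G (elements nr) (λ n → f (n ℤ.+ + a i) - f n)
      ≈⟨ sumOver-- (elements nr) (f ∘ (ℤ._+ + a i)) f ⟩
    sumOver G (elements nr) (f ∘ (ℤ._+ + a i)) - sumOver G (elements nr) f
      ≡⟨ cong (_- sumOver G (elements nr) f) (sumOver-map (ℤ._+ + a i) (elements nr) f) ⟨
    sumOver G nr+m f - sumOver G (elements nr) f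
      ≈⟨ w∙y≈x∙z⇒w-z≈x-y sums≈ ⟩
    sumOver G (elements nn) f - sumOver G [1⋯ a i -1] f ∎
    where
    nr+m : List ℤ
    nr+m = map (ℤ._+ + a i) (elements nr)
    sums≈ : sumOver G nr+m f ∙ sumOver G [1⋯ a i -1] f
          ≈ sumOver G (elements nn) f ∙ sumOver G (elements nr) f
    sums≈ = begin
      sumOver G nr+m f ∙ sumOver G [1⋯ a i -1] f             ≈⟨ sumOver-++ nr+m [1⋯ a i -1] f ⟨
      sumOver G (nr+m ++ [1⋯ a i -1]) f                      ≈⟨ sumOver-↭ f (shifted-NR-↭ a a>0 i nr nn) ⟩
      sumOver G (elements nn ++ elements nr) f               ≈⟨ sumOver-++ (elements nn) (elements nr) f ⟩
      sumOver G (elements nn) f ∙ sumOver G (elements nr) f  ∎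

-- The two finiteness components ensure that the identity, stated for arbitrary enumerations `nr`
-- and `nn`, is not vacuous.
theorem1 : ∀ {c ℓ} (G : AbelianGroup c ℓ) → let open AbelianGroup G in
    ∀ {k : ℕ} (a : Vector ℕ k) → (∀ j → 0 ℕ.< a j) → gcdᵥ a ≡ 1 →
    ∀ (i : Fin k) →
    Finite (NR a) × Finite (𝒩 a (a i)) ×
    (∀ (nr : Finite (NR a)) (nn : Finite (𝒩 a (a i))) (f : ℤ → Carrier) →
    sumOver G (elements nr) (λ n → f (n ℤ.+ + a i) - f n)
    ≈ sumOver G (elements nn) f - sumOver G [1⋯ a i -1] f)
theorem1 G a a>0 gcd≡1 i =
  NR-finite a a>0 gcd≡1 i , 𝒩-finite a a>0 gcd≡1 i , sumOver-NR-shift G a a>0 i
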